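{- For a connected graph $G$, let $\varphi$ be the relation on $E(G)$ defined by: $\{u,v\}\mathrel{\varphi}\{x,y\}$ iff $d(u,x)=d(v,y)$ and $d(u,y)=d(v,x)$. Then, for any connected graph $G$: (i) $\varphi$ is reflexive and symmetric; (ii) $\varphi$ is in general not transitive (i.e. there exist connected graphs for which $\varphi$ is not transitive); (iii) two distinct edges sharing a vertex are never $\varphi$-related; (iv) two distinct edges lying on a common shortest path are never $\varphi$-related; (v) in the even cycle $C_{2\nu}$ ($\nu\ge 2$) the maximal sets of pairwise $\varphi$-related edges are exactly the $\nu$ antipodal pairs of edges; (vi) in the odd cycle $C_{2\nu+1}$ ($\nu\ge 1$) no two distinct edges are $\varphi$-related.
   Context: Graphs are finite, simple, connected and undirected; $d=d_G$ is the shortest-path distance. The relation $\varphi$ does not depend on which endpoint of each edge is named first. In the cycle $C_{2\nu}$ with vertices $v_0,\dots,v_{2\nu-1}$ (indices mod $2\nu$), the antipodal pairs of edges are the pairs $\{v_a v_{a+1},\, v_{a+\nu}v_{a+\nu+1}\}$. -}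

module Defs where

open import Level using (0ℓ) renaming (suc to lsuc)
open import Data.Nat using (ℕ; zero; suc; _+_; _*_; _≤_; z≤n; s≤s; NonZero; >-nonZero)
import Data.Nat.Properties as ℕ
open import Data.Nat.DivMod
  using (_%_; _mod_; m%n<n; n%n≡0; %-distribˡ-+; m<n⇒m%n≡m)
open import Data.Fin using (Fin; toℕ; _≟_)
import Data.Fin.Properties as Fin
open import Data.List using (List; []; _∷_)
import Data.List as List
open import Data.List.Relation.Unary.Any using (Any)
open import Data.List.Relation.Unary.Unique.Propositional using (Unique)
open import Data.Product using (Σ; ∃; _×_; _,_; proj₁; proj₂)
open import Data.Sum using (_⊎_; inj₁; inj₂; [_,_])
import Data.Sum as Sum
open import Function using (_∘_)
open import Relation.Binary.Core using (Rel)
open import Relation.Binary.Bundles using (Setoid)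
open import Relation.Binary.Structures using (IsEquivalence)
import Relation.Binary.Definitions as B
import Relation.Binary.Construct.On as On
open import Relation.Binary.Construct.Closure.ReflexiveTransitive
  using (Star; ε; _◅_; _◅◅_; return; reverse)
open import Relation.Binary.PropositionalEquality
  using (_≡_; _≢_; refl; sym; trans; cong; subst; module ≡-Reasoning)
open import Relation.Nullary using (¬_; yes; no; contradiction)
open import Relation.Nullary.Decidable using (map′; _×-dec_; _⊎-dec_)
open import Relation.Unary using (Pred; Decidable; _⊆_; _≐_)
open import Relation.Unary.Relation.Binary.Equality using (≐-setoid)

------------------------------------------------------------------------
-- Finite simple connected graphs

record ConnectedGraph : Set (lsuc 0ℓ) where
  field
    order : ℕ

  Vertex : Set
  Vertex = Fin order

  field
    Adj           : Rel Vertex 0ℓ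
    adj?          : B.Decidable Adj
    adj-sym       : B.Symmetric Adj
    adj-irrefl    : ∀ {u} → ¬ Adj u u
    connected     : ∀ u v → Star Adj u v

  Walk : Rel Vertex 0ℓ
  Walk = Star Adj

open ConnectedGraph public using (Vertex; Walk)

-- An edge {u, v} is stored with its endpoints in some order; _≈_ identifies
-- the two orders (and ignores the adjacency proof), so that the edge set
-- E(G) is the setoid (Edge G, _≈_).

record Edge (G : ConnectedGraph) : Set where
  constructor edge
  open ConnectedGraph G using (Adj)
  field
    {src tgt} : Vertex G
    adj       : Adj src tgt

open Edge public using (src; tgt)

infix 4 _≈_ _φ_

_≈_ : ∀ {G} → Rel (Edge G) 0ℓ
e ≈ f = (src e ≡ src f × tgt e ≡ tgt f) ⊎ (src e ≡ tgt f × tgt e ≡ src f)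

≈-isEquivalence : ∀ {G} → IsEquivalence (_≈_ {G})
≈-isEquivalence = record
  { refl  = inj₁ (refl , refl)
  ; sym   = λ { (inj₁ (refl , refl)) → inj₁ (refl , refl)
              ; (inj₂ (refl , refl)) → inj₂ (refl , refl) }
  ; trans = λ { (inj₁ (refl , refl)) q → q
              ; (inj₂ (refl , refl)) (inj₁ (refl , refl)) → inj₂ (refl , refl)
              ; (inj₂ (refl , refl)) (inj₂ (refl , refl)) → inj₁ (refl , refl) }
  }

≈-dec : ∀ {G} → B.Decidable (_≈_ {G})
≈-dec e f = (src e ≟ src f ×-dec tgt e ≟ tgt f) ⊎-dec (src e ≟ tgt f ×-dec tgt e ≟ src f)

_IsEndOf_ : ∀ {G} → Vertex G → Edge G → Set
x IsEndOf e = x ≡ src e ⊎ x ≡ tgt e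

ShareVertex : ∀ {G} → Rel (Edge G) 0ℓ
ShareVertex e f = ∃ λ x → x IsEndOf e × x IsEndOf f

------------------------------------------------------------------------
-- Walks and distance

module _ (G : ConnectedGraph) where
  open ConnectedGraph G using (Adj; adj?)

  edges : ∀ {s t} → Walk G s t → List (Edge G)
  edges ε       = []
  edges (a ◅ w) = edge {G} a ∷ edges w

  vertices : ∀ {s t} → Walk G s t → List (Vertex G)
  vertices {s} ε       = s ∷ []
  vertices {s} (a ◅ w) = s ∷ vertices w

  walkLength : ∀ {s t} → Walk G s t → ℕ
  walkLength w = List.length (edges w)

  IsPath : ∀ {s t} → Walk G s t → Set
  IsPath w = Unique (vertices w)

  LiesOn : ∀ {s t} → Edge G → Walk G s t → Set
  LiesOn e w = Any (e ≈_) (edges w)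

  WalkOfLength : Vertex G → Vertex G → ℕ → Set
  WalkOfLength s t k = Σ (Walk G s t) λ w → walkLength w ≡ k

  walkOfLength? : ∀ s t → Decidable (WalkOfLength s t)
  walkOfLength? s t zero =
    map′ (λ { refl → ε , refl }) (λ { (ε , _) → refl }) (s ≟ t)
  walkOfLength? s t (suc k) =
    map′ (λ { (_ , a , w , refl) → a ◅ w , refl })
         (λ { (a ◅ w , refl) → _ , a , w , refl })
         (Fin.any? λ x → adj? s x ×-dec walkOfLength? x t k)

Least : Pred ℕ 0ℓ → Pred ℕ 0ℓ
Least P m = P m × (∀ k → P k → m ≤ k)

least : ∀ {P : Pred ℕ 0ℓ} → Decidable P → ∀ n → P n → ∃ (Least P)
least P? zero    p = zero , p , λ _ _ → z≤n
least P? (suc n) p with P? zero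
... | yes p₀ = zero , p₀ , λ _ _ → z≤n
... | no ¬p₀ with least (P? ∘ suc) n p
...   | m , q , m≤ = suc m , q , λ
        { zero    p₀ → contradiction p₀ ¬p₀
        ; (suc k) pk → s≤s (m≤ k pk) }

-- A walk of minimum length repeats no vertex, so minimising over walks and
-- minimising over paths give the same distance.

shortestLength : ∀ G s t → ∃ (Least (WalkOfLength G s t))
shortestLength G s t =
  least (walkOfLength? G s t) (walkLength G w) (w , refl)
  where w = ConnectedGraph.connected G s t

d : ∀ G → Vertex G → Vertex G → ℕ
d G s t = proj₁ (shortestLength G s t)

d-least : ∀ G s t → Least (WalkOfLength G s t) (d G s t)
d-least G s t = proj₂ (shortestLength G s t)

IsShortestPath : ∀ G {s t} → Walk G s t → Set
IsShortestPath G {s} {t} w = IsPath G w × walkLength G w ≡ d G s t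

------------------------------------------------------------------------
-- The relation φ

_φ_ : ∀ {G} → Rel (Edge G) 0ℓ
_φ_ {G} e f = d G (src e) (src f) ≡ d G (tgt e) (tgt f)
            × d G (src e) (tgt f) ≡ d G (tgt e) (src f)

φ-resp-≈ : ∀ {G} {e e′ f f′ : Edge G} → e ≈ e′ → f ≈ f′ → e φ f → e′ φ f′
φ-resp-≈ (inj₁ (refl , refl)) (inj₁ (refl , refl)) (p , q) = p , q
φ-resp-≈ (inj₁ (refl , refl)) (inj₂ (refl , refl)) (p , q) = q , p
φ-resp-≈ (inj₂ (refl , refl)) (inj₁ (refl , refl)) (p , q) = sym q , sym p
φ-resp-≈ (inj₂ (refl , refl)) (inj₂ (refl , refl)) (p , q) = sym p , sym q

------------------------------------------------------------------------
-- Sets of edges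

record EdgeSet (G : ConnectedGraph) : Set (lsuc 0ℓ) where
  field
    Member   : Pred (Edge G) 0ℓ
    member?  : Decidable Member
    respects : Member B.Respects _≈_

open EdgeSet public using (Member)

edgeSetSetoid : ConnectedGraph → Setoid (lsuc 0ℓ) 0ℓ
edgeSetSetoid G = On.setoid (≐-setoid (Edge G) 0ℓ) (Member {G})

pair : ∀ {G} → Edge G → Edge G → EdgeSet G
pair {G} e f = record
  { Member   = λ g → g ≈ e ⊎ g ≈ f
  ; member?  = λ g → ≈-dec g e ⊎-dec ≈-dec g f
  ; respects = λ {g} {h} g≈h → let h≈g = E.sym {g} {h} g≈h in
                 Sum.map (E.trans {h} {g} {e} h≈g) (E.trans {h} {g} {f} h≈g)
  }
  where module E = IsEquivalence (≈-isEquivalence {G})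

PairwiseRelated : ∀ {G} → EdgeSet G → Set
PairwiseRelated S = ∀ e f → Member S e → Member S f → e φ f

IsMaximalRelated : ∀ {G} → EdgeSet G → Set (lsuc 0ℓ)
IsMaximalRelated {G} S =
  PairwiseRelated S ×
  (∀ (T : EdgeSet G) → PairwiseRelated T → Member S ⊆ Member T → Member T ⊆ Member S)

------------------------------------------------------------------------
-- Cycles

module _ (n : ℕ) (3≤n : 3 ≤ n) where

  private
    instance
      n≢0 : NonZero n
      n≢0 = >-nonZero (ℕ.≤-trans (s≤s z≤n) 3≤n)

  1%n≡1 : 1 % n ≡ 1
  1%n≡1 = m<n⇒m%n≡m (ℕ.≤-trans (s≤s (s≤s z≤n)) 3≤n)

  -- v_a, with the index a read modulo n.
  cycleVertex : ℕ → Fin n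
  cycleVertex a = a mod n

  toℕ-cycleVertex : ∀ a → toℕ (cycleVertex a) ≡ a % n
  toℕ-cycleVertex a = Fin.toℕ-fromℕ< (m%n<n a n)

  cycleVertex-toℕ : ∀ i → cycleVertex (toℕ i) ≡ i
  cycleVertex-toℕ i = Fin.toℕ-injective
    (trans (toℕ-cycleVertex (toℕ i)) (m<n⇒m%n≡m (Fin.toℕ<n i)))

  next : Fin n → Fin n
  next i = cycleVertex (suc (toℕ i))

  next-cycleVertex : ∀ a → next (cycleVertex a) ≡ cycleVertex (suc a)
  next-cycleVertex a = Fin.toℕ-injective (begin
    toℕ (next (cycleVertex a))     ≡⟨ toℕ-cycleVertex (suc (toℕ (cycleVertex a))) ⟩
    suc (toℕ (cycleVertex a)) % n  ≡⟨ cong (λ k → suc k % n) (toℕ-cycleVertex a) ⟩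
    suc (a % n) % n                ≡⟨ cong (λ k → (k + a % n) % n) (sym 1%n≡1) ⟩
    (1 % n + a % n) % n            ≡⟨ sym (%-distribˡ-+ 1 a n) ⟩
    suc a % n                      ≡⟨ sym (toℕ-cycleVertex (suc a)) ⟩
    toℕ (cycleVertex (suc a))      ∎)
    where open ≡-Reasoning

  next-irrefl : ∀ i → next i ≢ i
  next-irrefl i eq with ℕ.m≤n⇒m<n∨m≡n (Fin.toℕ<n i)
  ... | inj₁ 1+i<n = ℕ.1+n≢n
        (trans (sym (trans (toℕ-cycleVertex _) (m<n⇒m%n≡m 1+i<n))) (cong toℕ eq))
  ... | inj₂ 1+i≡n = ℕ.<⇒≢ (ℕ.≤-trans (s≤s (s≤s z≤n)) 3≤n)
        (trans (cong suc 0≡i) 1+i≡n)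
        where
        0≡i : 0 ≡ toℕ i
        0≡i = trans (sym (trans (cong (_% n) 1+i≡n) (n%n≡0 n)))
                    (trans (sym (toℕ-cycleVertex _)) (cong toℕ eq))

  CycleAdj : Rel (Fin n) 0ℓ
  CycleAdj i j = j ≡ next i ⊎ i ≡ next j

  step : ∀ a → CycleAdj (cycleVertex a) (cycleVertex (suc a))
  step a = inj₁ (sym (next-cycleVertex a))

  fromZero : ∀ a → Star CycleAdj (cycleVertex 0) (cycleVertex a)
  fromZero zero    = ε
  fromZero (suc a) = fromZero a ◅◅ return (step a)

  fromZero′ : ∀ i → Star CycleAdj (cycleVertex 0) i
  fromZero′ i = subst (Star CycleAdj _) (cycleVertex-toℕ i) (fromZero (toℕ i))

  Cycle : ConnectedGraph
  Cycle = record
    { order      = n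
    ; Adj        = CycleAdj
    ; adj?       = λ i j → (j ≟ next i) ⊎-dec (i ≟ next j)
    ; adj-sym    = Sum.swap
    ; adj-irrefl = [ next-irrefl _ ∘ sym , next-irrefl _ ∘ sym ]
    ; connected  = λ i j → reverse Sum.swap (fromZero′ i) ◅◅ fromZero′ j
    }

  -- The edge v_a v_{a+1}.
  cycleEdge : ℕ → Edge Cycle
  cycleEdge a = edge {src = cycleVertex a} {tgt = cycleVertex (suc a)} (step a)

3≤2ν : ∀ {ν} → 2 ≤ ν → 3 ≤ 2 * ν
3≤2ν 2≤ν = ℕ.≤-trans (ℕ.n≤1+n 3) (ℕ.*-monoʳ-≤ 2 2≤ν)

3≤2ν+1 : ∀ {ν} → 1 ≤ ν → 3 ≤ 2 * ν + 1
3≤2ν+1 1≤ν = ℕ.+-monoˡ-≤ 1 (ℕ.*-monoʳ-≤ 2 1≤ν)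

EvenCycle : ∀ ν → 2 ≤ ν → ConnectedGraph
EvenCycle ν 2≤ν = Cycle (2 * ν) (3≤2ν 2≤ν)

OddCycle : ∀ ν → 1 ≤ ν → ConnectedGraph
OddCycle ν 1≤ν = Cycle (2 * ν + 1) (3≤2ν+1 1≤ν)

-- The index is read modulo 2ν, so a and a + ν name the same pair.
antipodalPair : ∀ ν (2≤ν : 2 ≤ ν) → ℕ → EdgeSet (EvenCycle ν 2≤ν)
antipodalPair ν 2≤ν a = pair (e a) (e (a + ν))
  where e = cycleEdge (2 * ν) (3≤2ν 2≤ν)

IsAntipodalPair : ∀ ν (2≤ν : 2 ≤ ν) → EdgeSet (EvenCycle ν 2≤ν) → Set
IsAntipodalPair ν 2≤ν S = ∃ λ a → Member S ≐ Member (antipodalPair ν 2≤ν a)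

-- All antipodal pairs, compared as sets of edges: a bijection of Fin ν with
-- this setoid says that there are exactly ν of them.
antipodalPairSetoid : ∀ ν → 2 ≤ ν → Setoid (lsuc 0ℓ) 0ℓ
antipodalPairSetoid ν 2≤ν =
  On.setoid {B = Σ (EdgeSet C) (IsAntipodalPair ν 2≤ν)} (edgeSetSetoid C) proj₁
  where C = EvenCycle ν 2≤ν

-- On a geodesic, or around a cycle, φ compares two distances that pass through
-- the same stretch of edges.  On a geodesic the pair of outer endpoints is
-- strictly further apart than the pair of inner ones.  In Cₙ one has
-- d(v_a, v_{a+k}) = min(k, n − k), so for 0 < k < n the edges v_a v_{a+1} and
-- v_{a+k} v_{a+k+1} are related iff min(k+1, n−k−1) = min(k−1, n−k+1), that is
-- iff n = 2k; hence only antipodal edges are related.  Failure of transitivity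
-- is seen in K₅: two edges with a common vertex can both be disjoint from a
-- third one, and disjoint edges of a complete graph are related.

{-# OPTIONS --safe #-}
module Submission where

open import Defs
open import Data.Nat
  using (ℕ; zero; suc; _+_; _*_; _∸_; _⊓_; _≤_; _<_; z≤n; s≤s; NonZero; >-nonZero; pred)
open import Data.Nat.Properties hiding (_≟_)
open import Data.Nat.DivMod
  using (_%_; _/_; m%n<n; m%n≤m; m<n⇒m%n≡m; m%n%n≡m%n; [m+kn]%n≡m%n; m≡m%n+[m/n]*n)
open import Data.Fin using (Fin; toℕ; fromℕ<; _≟_) renaming (zero to fzero; suc to fsuc)
import Data.Fin.Properties as Fin
open import Data.List.Relation.Unary.Any using (here; there)
open import Data.Product using (∃; ∃₂; _×_; _,_; proj₁; proj₂)
open import Data.Sum using (_⊎_; inj₁; inj₂)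
open import Function using (_∘_)
open import Function.Bundles using (_⇔_; mk⇔; Equivalence; Bijection)
open import Relation.Binary.Construct.Closure.ReflexiveTransitive
  using (Star; ε; _◅_; _◅◅_; return)
open import Relation.Binary.Definitions using (Reflexive; Symmetric; Transitive)
open import Relation.Binary.PropositionalEquality
  using (_≡_; _≢_; refl; sym; trans; cong; subst; subst₂; setoid; module ≡-Reasoning)
open import Relation.Binary.Structures using (IsEquivalence)
open import Relation.Nullary using (¬_; yes; no; contradiction)
open import Relation.Nullary.Decidable using (¬?)
open import Relation.Unary using (_≐_)

-- Distance in a connected graph

module Distance (G : ConnectedGraph) where
  open ConnectedGraph G using (adj-sym)

  walkLength-◅◅ : ∀ {s t u} (v : Walk G s t) (w : Walk G t u) →
                  walkLength G (v ◅◅ w) ≡ walkLength G v + walkLength G w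
  walkLength-◅◅ ε       w = refl
  walkLength-◅◅ (_ ◅ v) w = cong suc (walkLength-◅◅ v w)

  reverseWalk : ∀ {s t} (w : Walk G s t) → WalkOfLength G t s (walkLength G w)
  reverseWalk ε       = ε , refl
  reverseWalk (a ◅ w) with reverseWalk w
  ... | v , eq = v ◅◅ return (adj-sym a) , (begin
    walkLength G (v ◅◅ return (adj-sym a))  ≡⟨ walkLength-◅◅ v _ ⟩
    walkLength G v + 1                      ≡⟨ +-comm _ 1 ⟩
    suc (walkLength G v)                    ≡⟨ cong suc eq ⟩
    suc (walkLength G w)                    ∎)
    where open ≡-Reasoning

  d≤walkLength : ∀ {s t} (w : Walk G s t) → d G s t ≤ walkLength G w
  d≤walkLength w = proj₂ (d-least G _ _) _ (w , refl)

  geodesic : ∀ s t → WalkOfLength G s t (d G s t)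
  geodesic s t = proj₁ (d-least G s t)

  d-refl : ∀ s → d G s s ≡ 0
  d-refl s = n≤0⇒n≡0 (d≤walkLength ε)

  d≡0⇒≡ : ∀ {s t} → d G s t ≡ 0 → s ≡ t
  d≡0⇒≡ {s} {t} eq with geodesic s t
  ... | ε     , _   = refl
  ... | _ ◅ _ , eq′ = contradiction (trans eq′ eq) λ ()

  d-sym-≤ : ∀ s t → d G s t ≤ d G t s
  d-sym-≤ s t with geodesic t s
  ... | w , eq with reverseWalk w
  ...   | v , eq′ = ≤-trans (d≤walkLength v) (≤-reflexive (trans eq′ eq))

  d-sym : ∀ s t → d G s t ≡ d G t s
  d-sym s t = ≤-antisym (d-sym-≤ s t) (d-sym-≤ t s)

-- Edges sharing a vertex and edges on a geodesic

module _ {G : ConnectedGraph} where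
  open ConnectedGraph G using (Adj; adj-sym)
  open Distance G
  private module ≈ = IsEquivalence (≈-isEquivalence {G})

  φ-refl : Reflexive (_φ_ {G})
  φ-refl {e} = trans (d-refl (src e)) (sym (d-refl (tgt e))) , d-sym (src e) (tgt e)

  φ-sym : Symmetric (_φ_ {G})
  φ-sym {e} {f} (p , q) =
    trans (d-sym (src f) (src e)) (trans p (d-sym (tgt e) (tgt f))) ,
    trans (d-sym (src f) (tgt e)) (trans (sym q) (d-sym (src e) (tgt f)))

  -- Lets two edges with a common end be oriented away from it; `φ-resp-≈` then carries `φ` over.
  startAt : ∀ {x} (e : Edge G) → x IsEndOf e → ∃ λ (e′ : Edge G) → e ≈ e′ × src e′ ≡ x
  startAt e (inj₁ x≡) = e , ≈.refl {e} , sym x≡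
  startAt e (inj₂ x≡) = edge (adj-sym (Edge.adj e)) , inj₂ (refl , refl) , sym x≡

  -- With both edges leaving `x`, the first equation of `φ` makes the distance of their far ends
  -- d(x, x) = 0, so the far ends coincide as well.
  shareVertex∧φ⇒≈ : (e f : Edge G) → ShareVertex e f → e φ f → e ≈ f
  shareVertex∧φ⇒≈ e f (x , x∈e , x∈f) eφf with startAt e x∈e | startAt f x∈f
  ... | e′ , e≈e′ , refl | f′ , f≈f′ , src≡ =
    ≈.trans {e} {e′} {f} e≈e′ (≈.trans {e′} {f′} {f} e′≈f′ (≈.sym {f} {f′} f≈f′))
    where
    e′φf′ : e′ φ f′
    e′φf′ = φ-resp-≈ {e = e} {e′ = e′} {f = f} {f′ = f′} e≈e′ f≈f′ eφf

    e′≈f′ : e′ ≈ f′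
    e′≈f′ = inj₁ (sym src≡ , d≡0⇒≡ (begin
      d G (tgt e′) (tgt f′)  ≡⟨ proj₁ e′φf′ ⟨
      d G (src e′) (src f′)  ≡⟨ cong (d G (src e′)) src≡ ⟩
      d G (src e′) (src e′)  ≡⟨ d-refl (src e′) ⟩
      0                      ∎))
      where open ≡-Reasoning

  -- `f′` is `f` oriented in the direction of travel, so that the equations of `φ` can be read along
  -- the walk.
  splitAt : ∀ {s t} (f : Edge G) (w : Walk G s t) → LiesOn G f w →
            ∃ λ (f′ : Edge G) → f ≈ f′ ×
            ∃₂ λ (u : Walk G s (src f′)) (v : Walk G (tgt f′) t) →
            walkLength G w ≡ walkLength G u + suc (walkLength G v)
  splitAt f (a ◅ w) (here f≈a) = edge a , f≈a , ε , w , refl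
  splitAt f (a ◅ w) (there f∈w) with splitAt f w f∈w
  ... | f′ , f≈f′ , u , v , eq = f′ , f≈f′ , a ◅ u , v , cong suc eq

  IsMinimal : ∀ {s t} → Walk G s t → Set
  IsMinimal {s} {t} w = walkLength G w ≤ d G s t

  d≤1+d : ∀ {s s′ t} → Adj s s′ → d G s t ≤ suc (d G s′ t)
  d≤1+d {s} {s′} {t} a with geodesic s′ t
  ... | w , eq = ≤-trans (d≤walkLength (a ◅ w)) (≤-reflexive (cong suc eq))

  tail-minimal : ∀ {s s′ t} (a : Adj s s′) (w : Walk G s′ t) →
                 IsMinimal (a ◅ w) → IsMinimal w
  tail-minimal a w min = ≤-pred (≤-trans min (d≤1+d a))

  -- For `f′` pointing along the walk, `φ` equates the outer distance d(s, tgt f′) with the inner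
  -- distance d(s′, src f′), which is at most the length of `u`. A geodesic from `s` to `tgt f′`
  -- followed by `v` would then be at least two steps shorter than `a ◅ w`.
  first-unrelated : ∀ {s s′ t} (a : Adj s s′) (w : Walk G s′ t) →
                    IsMinimal (a ◅ w) → (e f : Edge G) → e ≈ edge a → LiesOn G f w →
                    ¬ (e φ f)
  first-unrelated {s} {s′} {t} a w min e f e≈a f∈w eφf with splitAt f w f∈w
  ... | f′ , f≈f′ , u , v , eq with geodesic s (tgt f′)
  ...   | g , |g|≡ = <-irrefl refl (begin-strict
    suc (walkLength G w)                     ≤⟨ min ⟩
    d G s t                                  ≤⟨ d≤walkLength (g ◅◅ v) ⟩
    walkLength G (g ◅◅ v)                    ≡⟨ walkLength-◅◅ g v ⟩
    walkLength G g + walkLength G v          ≡⟨ cong (_+ walkLength G v) |g|≡ ⟩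
    d G s (tgt f′) + walkLength G v          ≡⟨ cong (_+ walkLength G v) (proj₂ aφf′) ⟩
    d G s′ (src f′) + walkLength G v         ≤⟨ +-monoˡ-≤ _ (d≤walkLength u) ⟩
    walkLength G u + walkLength G v          ≤⟨ +-monoʳ-≤ _ (n≤1+n _) ⟩
    walkLength G u + suc (walkLength G v)    ≡⟨ eq ⟨
    walkLength G w                           <⟨ n<1+n _ ⟩
    suc (walkLength G w)                     ∎)
    where
    open ≤-Reasoning
    aφf′ : edge {G} a φ f′
    aφf′ = φ-resp-≈ {e = e} {e′ = edge a} {f = f} {f′ = f′} e≈a f≈f′ eφf

  onMinimalWalk∧φ⇒≈ : ∀ {s t} (w : Walk G s t) → IsMinimal w → (e f : Edge G) →
                      LiesOn G e w → LiesOn G f w → e φ f → e ≈ f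
  onMinimalWalk∧φ⇒≈ (a ◅ w) min e f (here e≈a) (here f≈a) eφf =
    ≈.trans {e} {edge a} {f} e≈a (≈.sym {f} {edge a} f≈a)
  onMinimalWalk∧φ⇒≈ (a ◅ w) min e f (here e≈a) (there f∈w) eφf =
    contradiction eφf (first-unrelated a w min e f e≈a f∈w)
  onMinimalWalk∧φ⇒≈ (a ◅ w) min e f (there e∈w) (here f≈a) eφf =
    contradiction (φ-sym {e} {f} eφf) (first-unrelated a w min f e f≈a e∈w)
  onMinimalWalk∧φ⇒≈ (a ◅ w) min e f (there e∈w) (there f∈w) eφf =
    onMinimalWalk∧φ⇒≈ w (tail-minimal a w min) e f e∈w f∈w eφf

-- Complete graphs

CompleteGraph : ℕ → ConnectedGraph
CompleteGraph n = record
  { order      = n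
  ; Adj        = _≢_
  ; adj?       = λ u v → ¬? (u ≟ v)
  ; adj-sym    = λ u≢v v≡u → u≢v (sym v≡u)
  ; adj-irrefl = λ u≢u → u≢u refl
  ; connected  = connected
  }
  where
  connected : ∀ (u v : Fin n) → Star _≢_ u v
  connected u v with u ≟ v
  ... | yes refl = ε
  ... | no  u≢v  = return u≢v

K₅-φ-not-transitive : ¬ Transitive (_φ_ {CompleteGraph 5})
K₅-φ-not-transitive φ-trans =
  -- All distances here evaluate: the four `refl` check 1 = 1, while the resulting equation d(0, 0)
  -- = d(1, 4) reads 0 = 1.
  contradiction (proj₁ (φ-trans {e₀₁} {e₂₃} {e₀₄} (refl , refl) (refl , refl))) λ ()
  where
  e₀₁ e₂₃ e₀₄ : Edge (CompleteGraph 5)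
  e₀₁ = edge {src = fzero} {tgt = fsuc fzero} λ ()
  e₂₃ = edge {src = fsuc (fsuc fzero)} {tgt = fsuc (fsuc (fsuc fzero))} λ ()
  e₀₄ = edge {src = fzero} {tgt = fsuc (fsuc (fsuc (fsuc fzero)))} λ ()

-- Cycles

-- The arithmetic behind `φ` for cycle edges at offset `suc j`. With n = j + 2 + r the two sides are
-- min(j + 2, r) and min(j, r + 2), which agree exactly when r = j.
⊓-balanced : ∀ {j n} → suc j < n →
            (suc (suc j) ⊓ (n ∸ suc (suc j)) ≡ j ⊓ (n ∸ j)) ⇔ (n ≡ 2 * suc j)
⊓-balanced {j} {n} 1+j<n with m≤n⇒∃[o]m+o≡n 1+j<n
... | r , refl = mk⇔ to from
  where
  open ≡-Reasoning
  outer≡ : suc (suc j) + r ∸ suc (suc j) ≡ r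
  outer≡ = m+n∸m≡n (suc (suc j)) r

  inner≡ : suc (suc j) + r ∸ j ≡ suc (suc r)
  inner≡ = trans (cong (_∸ j) (sym (trans (+-suc j (suc r)) (cong suc (+-suc j r)))))
                 (m+n∸m≡n j (suc (suc r)))

  double : suc (suc j) + j ≡ 2 * suc j
  double = cong suc (trans (sym (+-suc j j)) (cong (λ m → j + suc m) (sym (+-identityʳ j))))

  to′ : suc (suc j) ⊓ r ≡ j ⊓ suc (suc r) → r ≡ j
  -- Only r ≤ j + 2 together with j ≤ r + 2 survives, where the minima are r and j; elsewhere the
  -- two sides differ by at least two.
  to′ eq with ≤-total (suc (suc j)) r | ≤-total j (suc (suc r))
  ... | inj₁ j+2≤r | _ = contradiction
        (≤-trans (≤-reflexive (trans (sym (m≤n⇒m⊓n≡m j+2≤r)) eq)) (m⊓n≤m j _))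
        (<⇒≱ (≤-trans (n<1+n j) (n≤1+n _)))
  ... | inj₂ r≤j+2 | inj₁ j≤r+2 =
        trans (sym (m≥n⇒m⊓n≡n r≤j+2)) (trans eq (m≤n⇒m⊓n≡m j≤r+2))
  ... | inj₂ r≤j+2 | inj₂ r+2≤j = contradiction
        (trans (sym (m≥n⇒m⊓n≡n r≤j+2)) (trans eq (m≥n⇒m⊓n≡n r+2≤j)))
        (<⇒≢ (≤-trans (n<1+n r) (n≤1+n _)))

  to : suc (suc j) ⊓ (suc (suc j) + r ∸ suc (suc j)) ≡ j ⊓ (suc (suc j) + r ∸ j) →
       suc (suc j) + r ≡ 2 * suc j
  to eq = trans (cong (suc (suc j) +_) (to′ (begin
    suc (suc j) ⊓ r                                ≡⟨ cong (suc (suc j) ⊓_) outer≡ ⟨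
    suc (suc j) ⊓ (suc (suc j) + r ∸ suc (suc j))  ≡⟨ eq ⟩
    j ⊓ (suc (suc j) + r ∸ j)                      ≡⟨ cong (j ⊓_) inner≡ ⟩
    j ⊓ suc (suc r)                                ∎))) double

  from : suc (suc j) + r ≡ 2 * suc j →
         suc (suc j) ⊓ (suc (suc j) + r ∸ suc (suc j)) ≡ j ⊓ (suc (suc j) + r ∸ j)
  from eq with +-cancelˡ-≡ (suc (suc j)) r j (trans eq (sym double))
  ... | refl = begin
    suc (suc j) ⊓ (suc (suc j) + j ∸ suc (suc j))  ≡⟨ cong (suc (suc j) ⊓_) outer≡ ⟩
    suc (suc j) ⊓ j                                ≡⟨ ⊓-comm (suc (suc j)) j ⟩
    j ⊓ suc (suc j)                                ≡⟨ cong (j ⊓_) inner≡ ⟨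
    j ⊓ (suc (suc j) + j ∸ j)                      ∎

module _ {n : ℕ} (3≤n : 3 ≤ n) where

  private
    instance
      n≢0 : NonZero n
      n≢0 = >-nonZero (≤-trans (s≤s z≤n) 3≤n)

    v : ℕ → Fin n
    v = cycleVertex n 3≤n

    C : ConnectedGraph
    C = Cycle n 3≤n

    open Distance C

    e[_] : ℕ → Edge C
    e[_] = cycleEdge n 3≤n

    module E = IsEquivalence (≈-isEquivalence {C})

  -- Vertex indices modulo n

  v≡⇒%≡ : ∀ {a b} → v a ≡ v b → a % n ≡ b % n
  v≡⇒%≡ {a} {b} eq = trans (sym (toℕ-cycleVertex n 3≤n a))
    (trans (cong toℕ eq) (toℕ-cycleVertex n 3≤n b))

  %≡⇒v≡ : ∀ {a b} → a % n ≡ b % n → v a ≡ v b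
  %≡⇒v≡ {a} {b} eq = Fin.toℕ-injective (trans (toℕ-cycleVertex n 3≤n a)
    (trans eq (sym (toℕ-cycleVertex n 3≤n b))))

  v-injective : ∀ {a b} → a < n → b < n → v a ≡ v b → a ≡ b
  v-injective a<n b<n eq =
    trans (sym (m<n⇒m%n≡m a<n)) (trans (v≡⇒%≡ eq) (m<n⇒m%n≡m b<n))

  v-+kn : ∀ a k → v (a + k * n) ≡ v a
  v-+kn a k = %≡⇒v≡ ([m+kn]%n≡m%n a k n)

  v-+n : ∀ a → v (a + n) ≡ v a
  v-+n a = trans (cong (λ m → v (a + m)) (sym (*-identityˡ n))) (v-+kn a 1)

  v-suc : ∀ {a b} → v a ≡ v b → v (suc a) ≡ v (suc b)
  v-suc {a} {b} eq = trans (sym (next-cycleVertex n 3≤n a))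
    (trans (cong (next n 3≤n) eq) (next-cycleVertex n 3≤n b))

  v-+ˡ : ∀ c {a b} → v a ≡ v b → v (c + a) ≡ v (c + b)
  v-+ˡ zero    eq = eq
  v-+ˡ (suc c) eq = v-suc (v-+ˡ c eq)

  -- pred n * c acts as −c modulo n.
  negate-cancels : ∀ c a → v (pred n * c + (c + a)) ≡ v a
  negate-cancels c a = trans (cong v (begin
    pred n * c + (c + a)  ≡⟨ +-assoc (pred n * c) c a ⟨
    pred n * c + c + a    ≡⟨ cong (_+ a) (+-comm (pred n * c) c) ⟩
    suc (pred n) * c + a  ≡⟨ cong (λ m → m * c + a) (suc-pred n) ⟩
    n * c + a             ≡⟨ +-comm (n * c) a ⟩
    a + n * c             ≡⟨ cong (a +_) (*-comm n c) ⟩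
    a + c * n             ∎)) (v-+kn a c)
    where open ≡-Reasoning

  v-cancel-+ˡ : ∀ c {a b} → v (c + a) ≡ v (c + b) → v a ≡ v b
  v-cancel-+ˡ c {a} {b} eq = trans (sym (negate-cancels c a))
    (trans (v-+ˡ (pred n * c) eq) (negate-cancels c b))

  offset : ∀ a b → ∃ λ k → k < n × v (a + k) ≡ v b
  offset a b = k , m%n<n m n , (begin
    v (a + m % n)             ≡⟨ v-+ˡ a (%≡⇒v≡ (m%n%n≡m%n m n)) ⟩
    v (a + (pred n * a + b))  ≡⟨ cong v (+-assoc a (pred n * a) b) ⟨
    v (a + pred n * a + b)    ≡⟨ cong (λ x → v (x + b)) (+-comm a (pred n * a)) ⟩
    v (pred n * a + a + b)    ≡⟨ cong v (+-assoc (pred n * a) a b) ⟩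
    v (pred n * a + (a + b))  ≡⟨ negate-cancels a b ⟩
    v b                       ∎)
    where
    open ≡-Reasoning
    -- This represents b - a modulo n whichever of the two is larger.
    m = pred n * a + b
    k = m % n

  -- Walks and distances in a cycle

  forwardWalk : ∀ a k → WalkOfLength C (v a) (v (a + k)) k
  forwardWalk a zero rewrite +-identityʳ a = ε , refl
  forwardWalk a (suc k) rewrite +-suc a k with forwardWalk (suc a) k
  ... | w , eq = step n 3≤n a ◅ w , cong suc eq

  d≤offset : ∀ a k → d C (v a) (v (a + k)) ≤ k
  d≤offset a k with forwardWalk a k
  ... | w , eq = ≤-trans (d≤walkLength w) (≤-reflexive eq)

  -- p and q count the forward and the backward steps of the walk.
  steps : ∀ {s t} (w : Walk C s t) a b → s ≡ v a → t ≡ v b →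
          ∃₂ λ p q → p + q ≡ walkLength C w × v (p + a) ≡ v (q + b)
  steps ε a b s≡ t≡ = 0 , 0 , refl , trans (sym s≡) t≡
  steps (inj₁ s′≡ ◅ w) a b s≡ t≡
    with steps w (suc a) b
           (trans s′≡ (trans (cong (next n 3≤n) s≡) (next-cycleVertex n 3≤n a))) t≡
  ... | p , q , eq , eqᵥ = suc p , q , cong suc eq , trans (cong v (sym (+-suc p a))) eqᵥ
  steps (_◅_ {j = s′} (inj₂ s≡next) w) a b s≡ t≡
    -- After a backward step the tail is indexed from `toℕ s′`, since `a` may be 0 and have no
    -- predecessor in ℕ.
    with steps w (toℕ s′) b (sym (cycleVertex-toℕ n 3≤n s′)) t≡
  ... | p , q , eq , eqᵥ = p , suc q , trans (+-suc p q) (cong suc eq) , (begin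
    v (p + a)             ≡⟨ v-+ˡ p (trans (sym s≡) s≡next) ⟩
    v (p + suc (toℕ s′))  ≡⟨ cong v (+-suc p (toℕ s′)) ⟩
    v (suc (p + toℕ s′))  ≡⟨ v-suc eqᵥ ⟩
    v (suc q + b)         ∎)
    where open ≡-Reasoning

  -- A geodesic with p forward and q backward steps satisfies p ≡ q + k modulo n. If q + k < n, then
  -- p is at least q + k, hence at least k; otherwise q is at least n - k.
  offset≤d : ∀ a k → k ⊓ (n ∸ k) ≤ d C (v a) (v (a + k))
  offset≤d a k with geodesic (v a) (v (a + k))
  ... | w , |w|≡d with steps w a (a + k) refl refl
  ...   | p , q , p+q≡ , eqᵥ with v-cancel-+ˡ a {p} {q + k} (begin
    v (a + p)        ≡⟨ cong v (+-comm a p) ⟩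
    v (p + a)        ≡⟨ eqᵥ ⟩
    v (q + (a + k))  ≡⟨ cong v (trans (sym (+-assoc q a k))
                          (trans (cong (_+ k) (+-comm q a)) (+-assoc a q k))) ⟩
    v (a + (q + k))  ∎) | q + k <? n
    where open ≡-Reasoning
  ...     | p~q+k | yes q+k<n = begin
    k ⊓ (n ∸ k)              ≤⟨ m⊓n≤m k _ ⟩
    k                        ≤⟨ m≤n+m k q ⟩
    q + k                    ≡⟨ m<n⇒m%n≡m q+k<n ⟨
    (q + k) % n              ≡⟨ v≡⇒%≡ p~q+k ⟨
    p % n                    ≤⟨ m%n≤m p n ⟩
    p                        ≤⟨ m≤m+n p q ⟩
    p + q                    ≡⟨ trans p+q≡ |w|≡d ⟩
    d C (v a) (v (a + k))    ∎
    where open ≤-Reasoning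
  ...     | _ | no q+k≮n = begin
    k ⊓ (n ∸ k)              ≤⟨ m⊓n≤n k _ ⟩
    n ∸ k                    ≤⟨ m≤n+o⇒m∸n≤o n k (≤-trans (≮⇒≥ q+k≮n) (≤-reflexive (+-comm q k))) ⟩
    q                        ≤⟨ m≤n+m q p ⟩
    p + q                    ≡⟨ trans p+q≡ |w|≡d ⟩
    d C (v a) (v (a + k))    ∎
    where open ≤-Reasoning

  -- There are two ways round: k steps forward, or back along the n - k forward steps that lead from
  -- v(a + k) to v(a + n) = v(a). `offset≤d` says that nothing is shorter than both.
  d-cycle : ∀ a {k} → k ≤ n → d C (v a) (v (a + k)) ≡ k ⊓ (n ∸ k)
  d-cycle a {k} k≤n = ≤-antisym (⊓-glb (d≤offset a k) backward) (offset≤d a k)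
    where
    back : v (a + k + (n ∸ k)) ≡ v a
    back = trans (cong v (trans (+-assoc a k (n ∸ k)) (cong (a +_) (m+[n∸m]≡n k≤n)))) (v-+n a)

    backward : d C (v a) (v (a + k)) ≤ n ∸ k
    backward = begin
      d C (v a) (v (a + k))                    ≡⟨ d-sym (v a) (v (a + k)) ⟩
      d C (v (a + k)) (v a)                    ≡⟨ cong (d C (v (a + k))) back ⟨
      d C (v (a + k)) (v (a + k + (n ∸ k)))    ≤⟨ d≤offset (a + k) (n ∸ k) ⟩
      n ∸ k                                    ∎
      where open ≤-Reasoning

  -- Edges of a cycle and the relation `φ` between them

  e-cong : ∀ {a b} → v a ≡ v b → e[ a ] ≈ e[ b ]
  e-cong eq = inj₁ (eq , v-suc eq)

  -- A match with reversed ends would give v(b + 2) = v(b), hence v(2) = v(0), impossible for n at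
  -- least 3.
  e-injective : ∀ {a b} → e[ a ] ≈ e[ b ] → v a ≡ v b
  e-injective (inj₁ (eq , _)) = eq
  e-injective {a} {b} (inj₂ (va≡vb+1 , va+1≡vb)) =
    contradiction (v-injective 3≤n (≤-trans (s≤s z≤n) 3≤n) v2≡v0) λ ()
    where
    v2≡v0 : v 2 ≡ v 0
    v2≡v0 = v-cancel-+ˡ b (trans (cong v (+-comm b 2))
      (trans (v-suc (sym va≡vb+1)) (trans va+1≡vb (cong v (sym (+-identityʳ b))))))

  edge-index : ∀ e → ∃ λ a → e ≈ e[ a ]
  edge-index (edge {x} {y} (inj₁ y≡)) = toℕ x , inj₁ (sym (cycleVertex-toℕ n 3≤n x) , y≡)
  edge-index (edge {x} {y} (inj₂ x≡)) = toℕ y , inj₂ (x≡ , sym (cycleVertex-toℕ n 3≤n y))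

  edge-index-from : ∀ a e → ∃ λ k → k < n × e ≈ e[ a + k ]
  edge-index-from a e with edge-index e
  ... | b , e≈e[b] with offset a b
  ...   | k , k<n , eq = k , k<n , E.trans {e} {e[ b ]} {e[ a + k ]} e≈e[b] (e-cong (sym eq))

  -- The first equation of `φ` always holds, both distances having offset `suc j`. The second
  -- compares offsets j + 2 and j, which is `⊓-balanced`.
  φ-cycle : ∀ a {j} → suc j < n → (e[ a ] φ e[ a + suc j ]) ⇔ (n ≡ 2 * suc j)
  φ-cycle a {j} 1+j<n = mk⇔
    (λ { (_ , eq) → Equivalence.to (⊓-balanced 1+j<n)
                      (trans (sym outer) (trans eq inner)) })
    (λ n≡ → trans (d-cycle a (<⇒≤ 1+j<n)) (sym (d-cycle (suc a) (<⇒≤ 1+j<n))) ,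
            trans outer (trans (Equivalence.from (⊓-balanced 1+j<n) n≡)
                               (sym inner)))
    where
    outer : d C (v a) (v (suc (a + suc j))) ≡ suc (suc j) ⊓ (n ∸ suc (suc j))
    outer = trans (cong (λ x → d C (v a) (v x)) (sym (+-suc a (suc j)))) (d-cycle a 1+j<n)

    inner : d C (v (suc a)) (v (a + suc j)) ≡ j ⊓ (n ∸ j)
    inner = trans (cong (λ x → d C (v (suc a)) (v x)) (+-suc a j))
                  (d-cycle (suc a) (≤-trans (n≤1+n j) (<⇒≤ 1+j<n)))

  -- Common source of the odd and the even case: parity of n either rules out the second alternative
  -- or fixes its `k`.
  φ-cycle⇒ : ∀ a f → e[ a ] φ f → f ≈ e[ a ] ⊎ (∃ λ k → n ≡ 2 * k × f ≈ e[ a + k ])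
  φ-cycle⇒ a f eφf with edge-index-from a f
  ... | zero  , _   , f≈ = inj₁ (subst (λ x → f ≈ e[ x ]) (+-identityʳ a) f≈)
  ... | suc j , j<n , f≈ = inj₂ (suc j , Equivalence.to (φ-cycle a j<n)
        (φ-resp-≈ {e = e[ a ]} {e′ = e[ a ]} {f = f} {f′ = e[ a + suc j ]}
          (E.refl {e[ a ]}) f≈ eφf) , f≈)

-- Odd cycles

oddCycle-φ⇒≈ : ∀ ν (1≤ν : 1 ≤ ν) (e f : Edge (OddCycle ν 1≤ν)) → e φ f → e ≈ f
oddCycle-φ⇒≈ ν 1≤ν e f eφf with edge-index (3≤2ν+1 1≤ν) e
... | a , e≈ = go (φ-cycle⇒ (3≤2ν+1 1≤ν) a f
                (φ-resp-≈ {e = e} {e′ = e[ a ]} {f = f} {f′ = f} e≈ (E.refl {f}) eφf))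
  where
  module E = IsEquivalence (≈-isEquivalence {OddCycle ν 1≤ν})

  e[_] : ℕ → Edge (OddCycle ν 1≤ν)
  e[_] = cycleEdge (2 * ν + 1) (3≤2ν+1 1≤ν)

  go : f ≈ e[ a ] ⊎ (∃ λ k → 2 * ν + 1 ≡ 2 * k × f ≈ e[ a + k ]) → e ≈ f
  go (inj₁ f≈)                = E.trans {e} {e[ a ]} {f} e≈ (E.sym {f} {e[ a ]} f≈)
  go (inj₂ (k , 2ν+1≡2k , _)) =
    contradiction (trans (sym 2ν+1≡2k) (+-comm (2 * ν) 1)) (even≢odd k ν)

-- Even cycles

module _ {ν : ℕ} (2≤ν : 2 ≤ ν) where

  private
    3≤n : 3 ≤ 2 * ν
    3≤n = 3≤2ν 2≤ν

    C : ConnectedGraph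
    C = EvenCycle ν 2≤ν

    v : ℕ → Fin (2 * ν)
    v = cycleVertex (2 * ν) 3≤n

    e[_] : ℕ → Edge C
    e[_] = cycleEdge (2 * ν) 3≤n

    module E = IsEquivalence (≈-isEquivalence {C})

    _∈_ : Edge C → EdgeSet C → Set
    e ∈ S = Member S e

    antipodal : ℕ → EdgeSet C
    antipodal = antipodalPair ν 2≤ν

  ν<2ν : ν < 2 * ν
  ν<2ν = m<m+n ν (≤-trans (≤-trans (s≤s z≤n) 2≤ν) (≤-reflexive (sym (+-identityʳ ν))))

  antipodal-φ : ∀ a → e[ a ] φ e[ a + ν ]
  antipodal-φ a = go 2≤ν ν<2ν
    where
    go : 2 ≤ ν → ν < 2 * ν → e[ a ] φ e[ a + ν ]
    -- Matching on `s≤s` exposes `ν` as a successor, the form of the offset in `φ-cycle`.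
    go (s≤s _) ν<2ν = Equivalence.from (φ-cycle 3≤n a ν<2ν) refl

  -- From 2ν = 2k follows k = ν. Hence a pairwise related set containing `e[ a ]` lies inside the
  -- pair of `a`, which drives both directions of the characterisation.
  φ⇒∈antipodal : ∀ a f → e[ a ] φ f → f ∈ antipodal a
  φ⇒∈antipodal a f eφf with φ-cycle⇒ 3≤n a f eφf
  ... | inj₁ f≈ = inj₁ f≈
  ... | inj₂ (k , 2ν≡2k , f≈) with *-cancelˡ-≡ ν k 2 2ν≡2k
  ...   | refl = inj₂ f≈

  antipodal-pairwise : ∀ a → PairwiseRelated (antipodal a)
  antipodal-pairwise a e f e∈ f∈ = go e∈ f∈
    where
    resp : ∀ {x y} → x φ y → e ≈ x → f ≈ y → e φ f
    resp {x} {y} xφy e≈x f≈y =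
      φ-resp-≈ {e = x} {e′ = e} {f = y} {f′ = f} (E.sym {e} {x} e≈x) (E.sym {f} {y} f≈y) xφy

    go : e ∈ antipodal a → f ∈ antipodal a → e φ f
    go (inj₁ p) (inj₁ q) = resp {e[ a ]} {e[ a ]} (φ-refl {C} {e[ a ]}) p q
    go (inj₁ p) (inj₂ q) = resp {e[ a ]} {e[ a + ν ]} (antipodal-φ a) p q
    go (inj₂ p) (inj₁ q) =
      resp {e[ a + ν ]} {e[ a ]} (φ-sym {C} {e[ a ]} {e[ a + ν ]} (antipodal-φ a)) p q
    go (inj₂ p) (inj₂ q) = resp {e[ a + ν ]} {e[ a + ν ]} (φ-refl {C} {e[ a + ν ]}) p q

  e[a]∈antipodal : ∀ a → e[ a ] ∈ antipodal a
  e[a]∈antipodal a = inj₁ (E.refl {e[ a ]})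

  maximal⇒antipodal : ∀ S → IsMaximalRelated S → IsAntipodalPair ν 2≤ν S
  maximal⇒antipodal S (related , maximal)
    -- Membership is decidable and the 2ν edges can be searched, so a member of `S` is either found
    -- or excluded.
    with Fin.any? (λ (i : Fin (2 * ν)) → EdgeSet.member? S e[ toℕ i ])
  ... | yes (i , e∈S) = toℕ i , S⊆ , maximal (antipodal (toℕ i)) (antipodal-pairwise (toℕ i)) S⊆
    where
    S⊆ : ∀ {f} → f ∈ S → f ∈ antipodal (toℕ i)
    S⊆ {f} f∈S = φ⇒∈antipodal (toℕ i) f (related e[ toℕ i ] f e∈S f∈S)
  -- An empty `S` lies inside the pair of 0, so maximality would put `e[ 0 ]` into it.
  ... | no none = contradiction
        (maximal (antipodal 0) (antipodal-pairwise 0)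
          (λ {f} f∈S → contradiction f∈S (empty f)) {e[ 0 ]} (e[a]∈antipodal 0))
        (empty e[ 0 ])
    where
    empty : ∀ f → ¬ f ∈ S
    empty f f∈S with edge-index-from 3≤n 0 f
    ... | k , k<n , f≈ = none (fromℕ< k<n ,
          subst (λ m → e[ m ] ∈ S) (sym (Fin.toℕ-fromℕ< k<n))
            (EdgeSet.respects S {f} {e[ k ]} f≈ f∈S))

  -- A related `T` above the pair contains `e[ a ]`, so each of its members is related to `e[ a ]`
  -- and falls into the pair.
  antipodal⇒maximal : ∀ S → IsAntipodalPair ν 2≤ν S → IsMaximalRelated S
  antipodal⇒maximal S (a , S⊆ , ⊆S) =
    (λ e f e∈S f∈S → antipodal-pairwise a e f (S⊆ e∈S) (S⊆ f∈S)) ,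
    (λ T related S⊆T {f} f∈T → ⊆S {f} (φ⇒∈antipodal a f
      (related e[ a ] f (S⊆T {e[ a ]} (⊆S {e[ a ]} (e[a]∈antipodal a))) f∈T)))

  -- Counting the antipodal pairs

  antipodal-+ν : ∀ a → Member (antipodal a) ≐ Member (antipodal (a + ν))
  antipodal-+ν a = (λ {f} → to {f}) , (λ {f} → from {f})
    where
    -- Two half turns make a full turn, so a shift by `ν` merely swaps the two edges.
    round : v (a + ν + ν) ≡ v a
    round = trans (cong v (trans (+-assoc a ν ν)
      (cong (λ m → a + (ν + m)) (sym (+-identityʳ ν))))) (v-+n 3≤n a)

    to : ∀ {f} → f ∈ antipodal a → f ∈ antipodal (a + ν)
    to {f} (inj₁ p) = inj₂ (E.trans {f} {e[ a ]} {e[ a + ν + ν ]} p (e-cong 3≤n (sym round)))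
    to     (inj₂ p) = inj₁ p

    from : ∀ {f} → f ∈ antipodal (a + ν) → f ∈ antipodal a
    from     (inj₁ p) = inj₂ p
    from {f} (inj₂ p) = inj₁ (E.trans {f} {e[ a + ν + ν ]} {e[ a ]} p (e-cong 3≤n round))

  antipodal-+kν : ∀ a k → Member (antipodal a) ≐ Member (antipodal (a + k * ν))
  antipodal-+kν a zero =
    subst (λ m → Member (antipodal a) ≐ Member (antipodal m)) (sym (+-identityʳ a))
      ((λ z → z) , (λ z → z))
  antipodal-+kν a (suc k) =
    subst (λ m → Member (antipodal a) ≐ Member (antipodal m)) (+-assoc a ν (k * ν))
      ( (λ {f} → proj₁ (antipodal-+kν (a + ν) k) {f} ∘ proj₁ (antipodal-+ν a) {f})
      , (λ {f} → proj₂ (antipodal-+ν a) {f} ∘ proj₂ (antipodal-+kν (a + ν) k) {f}))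

  -- `e[ a ]` must be `e[ b ]` or `e[ b + ν ]`. All these indices are below 2ν, so a = b or a = b +
  -- ν, and the latter contradicts a < ν.
  antipodal-injective : ∀ {a b} → a < ν → b < ν →
                        Member (antipodal a) ≐ Member (antipodal b) → a ≡ b
  antipodal-injective {a} {b} a<ν b<ν (to , _) with to {e[ a ]} (e[a]∈antipodal a)
  ... | inj₁ p = v-injective 3≤n (<-trans a<ν ν<2ν) (<-trans b<ν ν<2ν) (e-injective 3≤n p)
  ... | inj₂ p = contradiction
        (≤-trans (m≤n+m ν b) (≤-reflexive (sym
          (v-injective 3≤n (<-trans a<ν ν<2ν)
            (+-mono-<-≤ b<ν (≤-reflexive (sym (+-identityʳ ν)))) (e-injective 3≤n p)))))
        (<⇒≱ a<ν)

  antipodal-bijection : Bijection (setoid (Fin ν)) (antipodalPairSetoid ν 2≤ν)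
  antipodal-bijection = record
    { to        = λ i → antipodal (toℕ i) , toℕ i , (λ z → z) , (λ z → z)
    ; cong      = λ { refl → (λ z → z) , (λ z → z) }
    ; bijective = (λ {i} {j} eq → Fin.toℕ-injective
                    (antipodal-injective (Fin.toℕ<n i) (Fin.toℕ<n j) eq))
                -- Equality in the target compares only the edge sets, so the index `a` may be
                -- replaced by its remainder modulo `ν`.
                , λ { (S , a , S⊆ , ⊆S) → reduced a , λ { refl →
                    (λ {f} → ⊆S {f} ∘ proj₁ (reduced-≐ a) {f}) ,
                    (λ {f} → proj₂ (reduced-≐ a) {f} ∘ S⊆ {f}) } }
    }
    where
    instance
      ν≢0 : NonZero ν
      ν≢0 = >-nonZero (≤-trans (s≤s z≤n) 2≤ν)

    reduced : ℕ → Fin ν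
    reduced a = fromℕ< (m%n<n a ν)

    reduced-≐ : ∀ a → Member (antipodal (toℕ (reduced a))) ≐ Member (antipodal a)
    reduced-≐ a = subst₂ (λ x y → Member (antipodal x) ≐ Member (antipodal y))
      (sym (Fin.toℕ-fromℕ< (m%n<n a ν))) (sym (m≡m%n+[m/n]*n a ν))
      (antipodal-+kν (a % ν) (a / ν))

theorem2p12 : ((G : ConnectedGraph) → Reflexive (_φ_ {G}) × Symmetric (_φ_ {G}))
    × (∃ λ (G : ConnectedGraph) → ¬ Transitive (_φ_ {G}))
    × ((G : ConnectedGraph) (e f : Edge G) → ¬ (e ≈ f) → ShareVertex e f → ¬ (e φ f))
    × ((G : ConnectedGraph) (s t : Vertex G) (p : Walk G s t) → IsShortestPath G p →
    (e f : Edge G) → ¬ (e ≈ f) → LiesOn G e p → LiesOn G f p → ¬ (e φ f))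
    × ((ν : ℕ) (2≤ν : 2 ≤ ν) →
    ((S : EdgeSet (EvenCycle ν 2≤ν)) → IsMaximalRelated S ⇔ IsAntipodalPair ν 2≤ν S)
    × Bijection (setoid (Fin ν)) (antipodalPairSetoid ν 2≤ν))
    × ((ν : ℕ) (1≤ν : 1 ≤ ν) (e f : Edge (OddCycle ν 1≤ν)) → ¬ (e ≈ f) → ¬ (e φ f))
theorem2p12 =
    (λ G → (λ {e} → φ-refl {G} {e}) , (λ {e} {f} → φ-sym {G} {e} {f}))
  , (CompleteGraph 5 , K₅-φ-not-transitive)
  , (λ G e f e≉f share eφf → e≉f (shareVertex∧φ⇒≈ e f share eφf))
  , (λ G s t p (_ , |p|≡d) e f e≉f e∈p f∈p eφf →
       e≉f (onMinimalWalk∧φ⇒≈ p (≤-reflexive |p|≡d) e f e∈p f∈p eφf))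
  , (λ ν 2≤ν → (λ S → mk⇔ (maximal⇒antipodal 2≤ν S) (antipodal⇒maximal 2≤ν S))
             , antipodal-bijection 2≤ν)
  , (λ ν 1≤ν e f e≉f eφf → e≉f (oddCycle-φ⇒≈ ν 1≤ν e f eφf))
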